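{- No randomized online algorithm for the Online Multi-Commodity Facility Location Problem with commodity set $S$ can achieve a competitive ratio better than $\Omega\left(\sqrt{|S|}\right)$, even on instances whose metric space consists of a single point. That is, there is an absolute constant $\kappa>0$ such that for every finite commodity set $S$ and every randomized online algorithm that is $c(|S|,n)$-competitive on single-point instances with commodity set $S$, one has $c(|S|,n)\ge \kappa\sqrt{|S|}$ for all sufficiently large $n$.
   Context: Online Multi-Commodity Facility Location Problem (OMFLP). An instance consists of a finite metric space with point set $M$ and distance $d$, a finite nonempty set $S$ of commodities, construction costs $f_m^\sigma\ge 0$ for all $m\in M$ and $\sigma\subseteq S$ (all known in advance), and a sequence of $n$ requests. Each request $r$ is located at a point of $M$ and demands a nonempty set $s_r\subseteq S$; $d(m,r)$ denotes the distance from $m\in M$ to the location of $r$. A solution opens facilities, each at a point $m\in M$ with a configuration $\sigma\subseteq S$ (the set of commodities it offers), at cost $f_m^\sigma$; several facilities may be opened at the same point. Each request $r$ is assigned to a set of open facilities that jointly offer all commodities of $s_r$, at assignment cost equal to the sum of the distances from $r$ to these facilities. The total cost is the sum of all construction and assignment costs. Requests are revealed one by one; on arrival a request must immediately be assigned, where the algorithm may first open new facilities; all decisions are irrevocable. Standing assumptions on the costs: subadditivity, $f_m^{a\cup b}\le f_m^a+f_m^b$ for all $m\in M$, $a,b\subseteq S$; and $f_m^\sigma/|\sigma|\ge f_m^S/|S|$ for all $m\in M$ and nonempty $\sigma\subseteq S$. Competitive ratio: a (randomized) online algorithm is $c(|S|,n)$-competitive if there is a constant $a$, independent of the instance, such that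 on every instance its (expected) cost is at most $c(|S|,n)\cdot \mathrm{OPT}+a$, where OPT is the optimal offline cost of the instance and $n$ its number of requests. -}

module Defs where

open import Algebra.Apartness.Bundles using (HeytingField; HeytingCommutativeRing)
open import Algebra.Bundles using (CommutativeRing)
import Algebra.Definitions.RawMonoid as RawMonoidDefs
open import Data.Bool.Base using (if_then_else_)
open import Data.Fin.Base using (Fin)
open import Data.Fin.Subset using (Subset; ∣_∣; _∪_; ⊤; Nonempty; _∈_)
open import Data.List.Base using (List; []; _∷_; _++_; length; foldr)
import Data.List.Base as List
open import Data.Nat.Base as ℕ using (ℕ; zero; suc; NonZero)
open import Data.Product.Base using (Σ-syntax; ∃-syntax; _×_; _,_; proj₁)
open import Data.Sum.Base using (_⊎_; inj₂)
import Data.Vec.Base as Vec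
open import Function.Metric.Structures using (IsGeneralMetric)
open import Level using (Level; _⊔_) renaming (suc to lsuc)
open import Relation.Binary.Core using (Rel)
open import Relation.Binary.Definitions using (Cotransitive)
open import Relation.Binary.PropositionalEquality.Core using (_≡_)
open import Relation.Binary.Structures using (IsStrictPartialOrder)
open import Relation.Nullary.Negation.Core using (¬_)

private
  variable
    c ℓ₁ ℓ₂ ℓ₃ o p : Level

-- The order relations and limits of a field carrying a strict order.  In a
-- constructive ordered field, x ≤ y is the negation of y < x.

module OrderNotions (F : HeytingField c ℓ₁ ℓ₂)
                    (_<_ : Rel (HeytingField.Carrier F) ℓ₃) where

  open HeytingField F
  open CommutativeRing (HeytingCommutativeRing.commutativeRing heytingCommutativeRing)
    public using (+-rawMonoid)
  open RawMonoidDefs +-rawMonoid using () renaming (_×_ to _·_)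

  infix 4 _≤_ _⟶_

  _≤_ : Rel Carrier ℓ₃
  x ≤ y = ¬ (y < x)

  fromℕ : ℕ → Carrier
  fromℕ n = n · 1#

  Cauchy : (ℕ → Carrier) → Set _
  Cauchy x = ∀ ε → 0# < ε →
    ∃[ N ] ∀ m n → N ℕ.≤ m → N ℕ.≤ n → x m < (x n + ε)

  _⟶_ : (ℕ → Carrier) → Carrier → Set _
  x ⟶ l = ∀ ε → 0# < ε →
    ∃[ N ] ∀ n → N ℕ.≤ n → (x n < (l + ε)) × (l < (x n + ε))

-- Complete Archimedean ordered fields.  Up to isomorphism the real numbers
-- are the only one; the axioms are phrased so that they also hold for
-- constructive reals, whose order is not decidable.

record RealNumbers c ℓ₁ ℓ₂ ℓ₃ : Set (lsuc (c ⊔ ℓ₁ ⊔ ℓ₂ ⊔ ℓ₃)) where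
  infix 4 _<_
  infixl 7 _/_
  field
    heytingField : HeytingField c ℓ₁ ℓ₂

  open HeytingField heytingField public

  field
    _<_                  : Rel Carrier ℓ₃
    isStrictPartialOrder : IsStrictPartialOrder _≈_ _<_
    <-cotrans            : Cotransitive _<_
    #⇒<⊎>                : ∀ {x y} → x # y → x < y ⊎ y < x
    <⊎>⇒#                : ∀ {x y} → x < y ⊎ y < x → x # y
    0<1                  : 0# < 1#
    +-monoˡ-<            : ∀ {x y} z → x < y → x + z < y + z
    *-pos                : ∀ {x y} → 0# < x → 0# < y → 0# < x * y

  open OrderNotions heytingField _<_ public

  field
    archimedean : ∀ x → ∃[ n ] x < fromℕ n
    complete    : ∀ x → Cauchy x → ∃[ l ] x ⟶ l

  open IsStrictPartialOrder isStrictPartialOrder public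
    using (<-respˡ-≈; <-respʳ-≈) renaming (trans to <-trans; irrefl to <-irrefl)

  open RawMonoidDefs +-rawMonoid public using (sum)

  0<fromℕ-suc : ∀ n → 0# < fromℕ (suc n)
  0<fromℕ-suc zero    = <-respʳ-≈ (sym (+-identityʳ 1#)) 0<1
  0<fromℕ-suc (suc n) = <-trans (0<fromℕ-suc n)
    (<-respˡ-≈ (+-identityˡ (fromℕ (suc n))) (+-monoˡ-< (fromℕ (suc n)) 0<1))

  -- The Heyting field axioms provide the inverse of n as that of n - 0.
  _/_ : Carrier → (n : ℕ) → .{{NonZero n}} → Carrier
  x / suc n = x * proj₁ (#⇒invertible (<⊎>⇒# (inj₂ (0<fromℕ-suc n))))

  IsSqrt : Carrier → Carrier → Set _
  IsSqrt r x = 0# ≤ r × r * r ≈ x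

  IsMax : Carrier → Carrier → Carrier → Set _
  IsMax z x y = x ≤ z × y ≤ z × (∀ w → x ≤ w → y ≤ w → z ≤ w)

module _ (ℝ : RealNumbers c ℓ₁ ℓ₂ ℓ₃) where
  open RealNumbers ℝ

  -- Probability spaces in Daniell's form: a vector lattice of integrable
  -- random variables containing the constants, with a normalised positive
  -- linear expectation that is continuous along sequences decreasing to 0.
  -- The integrable functions of any probability measure are an example, and
  -- by the Daniell–Stone theorem every example is an expectation with respect
  -- to a probability measure.

  record ProbabilitySpace o p : Set (c ⊔ ℓ₁ ⊔ ℓ₃ ⊔ lsuc (o ⊔ p)) where
    field
      Ω          : Set o
      Integrable : (Ω → Carrier) → Set p
      𝔼          : (X : Ω → Carrier) → Integrable X → Carrier

      integrable-resp  : ∀ {X Y} → (∀ ω → X ω ≈ Y ω) → Integrable X → Integrable Y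
      integrable-const : ∀ x → Integrable (λ _ → x)
      integrable-+     : ∀ {X Y} → Integrable X → Integrable Y →
                         Integrable (λ ω → X ω + Y ω)
      integrable-*     : ∀ x {X} → Integrable X → Integrable (λ ω → x * X ω)
      integrable-max   : ∀ {X Y Z} → Integrable X → Integrable Y →
                         (∀ ω → IsMax (Z ω) (X ω) (Y ω)) → Integrable Z

      𝔼-1    : ∀ i → 𝔼 (λ _ → 1#) i ≈ 1#
      𝔼-+    : ∀ {X Y} i j k → 𝔼 (λ ω → X ω + Y ω) k ≈ 𝔼 X i + 𝔼 Y j
      𝔼-*    : ∀ x {X} i j → 𝔼 (λ ω → x * X ω) j ≈ x * 𝔼 X i
      𝔼-pos  : ∀ {X} i → (∀ ω → 0# ≤ X ω) → 0# ≤ 𝔼 X i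
      𝔼-cont : ∀ (X : ℕ → Ω → Carrier) (i : ∀ n → Integrable (X n)) →
               (∀ n ω → X (suc n) ω ≤ X n ω) →
               (∀ ω → (λ n → X n ω) ⟶ 0#) →
               (λ n → 𝔼 (X n) (i n)) ⟶ 0#

-- The problem with commodity set S = Fin s.

module OMFLP (ℝ : RealNumbers c ℓ₁ ℓ₂ ℓ₃) (s : ℕ) .{{_ : NonZero s}} where
  open RealNumbers ℝ

  -- The part of an instance that is known in advance.

  record Environment : Set (c ⊔ ℓ₁ ⊔ ℓ₃) where
    field
      size     : ℕ

    Point : Set
    Point = Fin size

    field
      d        : Point → Point → Carrier
      isMetric : IsGeneralMetric _≡_ _≈_ _≤_ 0# _+_ d
      f        : Point → Subset s → Carrier
      f-nonneg : ∀ m σ → 0# ≤ f m σ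
      f-subadd : ∀ m a b → f m (a ∪ b) ≤ f m a + f m b
      f-share  : ∀ m σ .{{_ : NonZero ∣ σ ∣}} → f m ⊤ / s ≤ f m σ / ∣ σ ∣

  SinglePoint : Environment → Set
  SinglePoint E = Environment.size E ≡ 1

  module _ (E : Environment) where
    open Environment E

    record Request : Set where
      field
        location : Point
        demand   : Subset s
        nonempty : Nonempty demand

    record Facility : Set where
      field
        point  : Point
        config : Subset s

  open Request public
  open Facility public

  module _ {E : Environment} where
    open Environment E

    constructionCost : List (Facility E) → Carrier
    constructionCost = foldr (λ φ t → f (point φ) (config φ) + t) 0#

    -- A set of open facilities is a set of positions in the list of them, so
    -- that facilities with equal point and configuration stay distinct.

    assignmentCost : (φs : List (Facility E)) → Subset (length φs) → Request E → Carrier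
    assignmentCost φs A r =
      sum λ j → if Vec.lookup A j
                then d (point (List.lookup φs j)) (location r)
                else 0#

    Serves : (φs : List (Facility E)) → Subset (length φs) → Request E → Set
    Serves φs A r =
      ∀ e → e ∈ demand r → ∃[ j ] j ∈ A × e ∈ config (List.lookup φs j)

    record OfflineSolution (rs : List (Request E)) : Set where
      field
        facilities : List (Facility E)
        assign     : Fin (length rs) → Subset (length facilities)
        serves     : ∀ i → Serves facilities (assign i) (List.lookup rs i)

      cost : Carrier
      cost = constructionCost facilities
           + sum (λ i → assignmentCost facilities (assign i) (List.lookup rs i))

    IsOPT : List (Request E) → Carrier → Set _
    IsOPT rs v = (Σ[ sol ∈ OfflineSolution rs ] OfflineSolution.cost sol ≈ v)
               × (∀ (sol : OfflineSolution rs) → v ≤ OfflineSolution.cost sol)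

    -- Request sequences are listed latest request first: in r ∷ rs the
    -- request r arrives after all of rs.

    allOpened : (List (Request E) → Request E → List (Facility E)) →
                List (Request E) → List (Facility E)
    allOpened opens []       = []
    allOpened opens (r ∷ rs) = opens rs r ++ allOpened opens rs

  -- Deterministic online behaviour: opens rs r are the facilities newly opened
  -- when r arrives after rs, and assign rs r the facilities then assigned to r.

  record Strategy (E : Environment) : Set where
    field
      opens  : List (Request E) → Request E → List (Facility E)
      assign : ∀ rs r → Subset (length (allOpened opens (r ∷ rs)))
      serves : ∀ rs r → Serves (allOpened opens (r ∷ rs)) (assign rs r) r

    cost : List (Request E) → Carrier
    cost []       = 0#
    cost (r ∷ rs) = cost rs
                  + (constructionCost (opens rs r)
                     + assignmentCost (allOpened opens (r ∷ rs)) (assign rs r) r)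

  record RandomizedAlgorithm o p : Set (c ⊔ ℓ₁ ⊔ ℓ₃ ⊔ lsuc (o ⊔ p)) where
    field
      space    : ProbabilitySpace ℝ o p

    open ProbabilitySpace space public

    field
      strategy : Ω → (E : Environment) → Strategy E

    cost : (E : Environment) → List (Request E) → Ω → Carrier
    cost E rs ω = Strategy.cost (strategy ω E) rs

  -- ratio n is the competitive ratio allowed on instances with n requests.
  -- A random cost that is not integrable has no finite expectation, hence
  -- satisfies no such bound.

  CompetitiveOn : (Environment → Set) → RandomizedAlgorithm o p → (ℕ → Carrier) → Set _
  CompetitiveOn P A ratio =
    ∃[ a ] ∀ E → P E → ∀ (rs : List (Request E)) opt → IsOPT rs opt →
      Σ[ i ∈ Integrable (cost E rs) ] 𝔼 (cost E rs) i ≤ ratio (length rs) * opt + a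
    where open RandomizedAlgorithm A

{-# OPTIONS --safe #-}
module Submission where

-- On a single point let a configuration σ cost k (q + |σ|) with q = ⌊√s⌋, and
-- let each of the last q requests demand one uniformly random commodity.  The
-- optimum buys a single facility for at most 3 k q.  Online, let F be the number
-- of facilities and W the total size of their configurations.  A request that
-- finds its commodity uncovered forces a new facility, and it does so with
-- probability at least 1 - W/s; a large W is itself expensive.  Since q² ≤ s,
-- this makes the expected cost k (q F + W) at least k q² for every deterministic
-- strategy, hence for every randomized one.  Letting k grow removes the additive
-- constant of the competitive ratio.

open import Algebra.Apartness.Bundles using (HeytingCommutativeRing)
open import Algebra.Bundles using (CommutativeRing)
open import Algebra.Definitions.RawMonoid using () renaming (sum to sumOf)
import Algebra.Properties.Ring as RingProperties
import Algebra.Properties.Semiring.Mult as SemiringMult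
import Algebra.Solver.Ring.NaturalCoefficients.Default as SemiringSolver
open import Data.Bool.Base using (true; false; if_then_else_)
open import Data.Empty using (⊥-elim)
open import Data.Fin.Base using (Fin; zero; suc)
open import Data.Fin.Subset using (Subset; ∣_∣; _∪_; _⊆_; _∈_; ⁅_⁆; ⊤; ⊥)
import Data.Fin.Subset.Properties as Subset
open import Data.List.Base as List using (List; []; _∷_; _++_; length; replicate)
import Data.List.Properties as List
open import Data.Nat.Base as ℕ using (ℕ; zero; suc; NonZero; z≤n; s≤s)
import Data.Nat.Properties as ℕ
open import Data.Nat.Tactic.RingSolver using (solve-∀)
open import Data.Product.Base using (∃-syntax; Σ-syntax; _×_; _,_; proj₁)
open import Data.Sum.Base using (inj₁; inj₂)
open import Data.Vec.Base as Vec using ([]; _∷_)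
open import Data.Vec.Properties using ([]=⇒lookup)
open import Function.Metric.Structures using (IsGeneralMetric)
open import Level using (Level)
open import Relation.Binary.Definitions using (Asymmetric)
open import Relation.Binary.PropositionalEquality.Core as ≡ using (_≡_)
import Relation.Binary.PropositionalEquality.Properties as ≡
import Relation.Binary.Reasoning.Base.Triple as TripleReasoning
open import Relation.Binary.Structures using (IsPartialOrder)
open import Relation.Nullary.Decidable.Core using (yes; no)
open import Relation.Nullary.Negation.Core using (¬_)
open import Defs

private
  variable
    c ℓ₁ ℓ₂ ℓ₃ o p : Level

-- Integer square roots, sizes of unions, finite sums of naturals.

isqrt : ∀ n → ∃[ m ] m ℕ.* m ℕ.≤ n × n ℕ.< suc m ℕ.* suc m
isqrt zero    = 0 , z≤n , s≤s z≤n
isqrt (suc n) with isqrt n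
... | m , m²≤n , n<[1+m]² with suc m ℕ.* suc m ℕ.≤? suc n
...   | yes [1+m]²≤1+n = suc m , [1+m]²≤1+n , (begin-strict
        suc n                      ≤⟨ n<[1+m]² ⟩
        suc m ℕ.* suc m            <⟨ ℕ.*-mono-< (ℕ.n<1+n (suc m)) (ℕ.n<1+n (suc m)) ⟩
        suc (suc m) ℕ.* suc (suc m) ∎)
  where open ℕ.≤-Reasoning
...   | no [1+m]²≰1+n = m , ℕ.m≤n⇒m≤1+n m²≤n , ℕ.≰⇒> [1+m]²≰1+n

∣p∪q∣≤∣p∣+∣q∣ : ∀ {n} (p q : Subset n) → ∣ p ∪ q ∣ ℕ.≤ ∣ p ∣ ℕ.+ ∣ q ∣
∣p∪q∣≤∣p∣+∣q∣ []          []          = z≤n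
∣p∪q∣≤∣p∣+∣q∣ (true  ∷ p) (true  ∷ q) =
  s≤s (ℕ.≤-trans (∣p∪q∣≤∣p∣+∣q∣ p q) (ℕ.+-monoʳ-≤ ∣ p ∣ (ℕ.n≤1+n ∣ q ∣)))
∣p∪q∣≤∣p∣+∣q∣ (true  ∷ p) (false ∷ q) = s≤s (∣p∪q∣≤∣p∣+∣q∣ p q)
∣p∪q∣≤∣p∣+∣q∣ (false ∷ p) (true  ∷ q) =
  ℕ.≤-trans (s≤s (∣p∪q∣≤∣p∣+∣q∣ p q)) (ℕ.≤-reflexive (≡.sym (ℕ.+-suc ∣ p ∣ ∣ q ∣)))
∣p∪q∣≤∣p∣+∣q∣ (false ∷ p) (false ∷ q) = ∣p∪q∣≤∣p∣+∣q∣ p q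

∑ : ∀ {n} → (Fin n → ℕ) → ℕ
∑ = sumOf ℕ.+-0-rawMonoid

indicator : ∀ {n} → Subset n → Fin n → ℕ
indicator p e = if Vec.lookup p e then 1 else 0

∑-indicator : ∀ {n} (p : Subset n) → ∑ (indicator p) ≡ ∣ p ∣
∑-indicator []          = ≡.refl
∑-indicator (true  ∷ p) = ≡.cong suc (∑-indicator p)
∑-indicator (false ∷ p) = ∑-indicator p

-- Averages a pointwise bound without dividing. The factors `a` and `b` stay outside the sums, so
-- that `∑ g` can later be evaluated as the size of a covered set.
∑-lower : ∀ {n} x a b (f g : Fin n → ℕ) → (∀ e → x ℕ.≤ a ℕ.* f e ℕ.+ b ℕ.* g e) →
          n ℕ.* x ℕ.≤ a ℕ.* ∑ f ℕ.+ b ℕ.* ∑ g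
∑-lower {zero}  x a b f g x≤ = z≤n
∑-lower {suc n} x a b f g x≤ = begin
  x ℕ.+ n ℕ.* x
    ≤⟨ ℕ.+-mono-≤ (x≤ zero) (∑-lower x a b f′ g′ (λ e → x≤ (suc e))) ⟩
  (a ℕ.* f zero ℕ.+ b ℕ.* g zero) ℕ.+ (a ℕ.* ∑ f′ ℕ.+ b ℕ.* ∑ g′)
    ≡⟨ rearrange a b (f zero) (g zero) (∑ f′) (∑ g′) ⟩
  a ℕ.* ∑ f ℕ.+ b ℕ.* ∑ g ∎
  where
  open ℕ.≤-Reasoning
  f′ g′ : Fin n → ℕ
  f′ e = f (suc e)
  g′ e = g (suc e)

  rearrange : ∀ a b u v w z → (a ℕ.* u ℕ.+ b ℕ.* v) ℕ.+ (a ℕ.* w ℕ.+ b ℕ.* z)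
                            ≡ a ℕ.* (u ℕ.+ w) ℕ.+ b ℕ.* (v ℕ.+ z)
  rearrange = solve-∀

-- Expected cost of random continuations, counted in naturals.

module _ {n : ℕ} where

  -- This is `n ^ t` times the expectation of `g` after `t` further uniformly random elements; left
  -- unnormalised, it stays a natural number. New elements go to the front because request sequences
  -- are listed latest first.
  extensionSum : ℕ → (List (Fin n) → ℕ) → List (Fin n) → ℕ
  extensionSum zero    g es = g es
  extensionSum (suc t) g es = ∑ λ e → extensionSum t g (e ∷ es)

  -- The parameters abstract a deterministic online run with history `es`: `F` counts facilities,
  -- `W` is their total configuration size, `U` the set of covered commodities. `F-step` expresses
  -- that a request finds its commodity in `U` or forces a new facility.
  module _ (q : ℕ) (F W : List (Fin n) → ℕ) (U : List (Fin n) → Subset n)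
           (∣U∣≤W  : ∀ es → ∣ U es ∣ ℕ.≤ W es)
           (W-mono : ∀ es e → W es ℕ.≤ W (e ∷ es))
           (F-step : ∀ es e → suc (F es) ℕ.≤ F (e ∷ es) ℕ.+ indicator (U es) e) where

    private
      cost : List (Fin n) → ℕ
      cost es = q ℕ.* F es ℕ.+ W es

      potential : ℕ → ℕ → List (Fin n) → ℕ
      potential t d es = n ℕ.* q ℕ.* F es ℕ.+ n ℕ.* q ℕ.* t ℕ.+ d ℕ.* W es

    -- Covered commodities are expected to save t more random requests at most
    -- t W / n facilities of cost q, so W counts with weight 1 - t q / n = d / n.
    extensionSum-lower : ∀ t d → n ≡ t ℕ.* q ℕ.+ d → ∀ es →
      n ℕ.^ t ℕ.* potential t d es ℕ.≤ n ℕ.* extensionSum t cost es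
    extensionSum-lower zero d n≡d es = ℕ.≤-reflexive (≡.trans
      (≡.cong (λ m → 1 ℕ.* (n ℕ.* q ℕ.* F es ℕ.+ n ℕ.* q ℕ.* 0 ℕ.+ m ℕ.* W es)) (≡.sym n≡d))
      (rearrange n q (F es) (W es)))
      where
      rearrange : ∀ n q f w → 1 ℕ.* (n ℕ.* q ℕ.* f ℕ.+ n ℕ.* q ℕ.* 0 ℕ.+ n ℕ.* w)
                            ≡ n ℕ.* (q ℕ.* f ℕ.+ w)
      rearrange = solve-∀
    -- Lowering the weight of `W` from `q + d` to `d` is done by adding the difference to both
    -- sides, which avoids truncated subtraction.
    extensionSum-lower (suc t) d n≡ es = ℕ.+-cancelʳ-≤ (n ℕ.^ t ℕ.* (n ℕ.* q) ℕ.* W es) _ _ (begin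
      n ℕ.^ suc t ℕ.* potential (suc t) d es ℕ.+ n ℕ.^ t ℕ.* (n ℕ.* q) ℕ.* W es
        ≡⟨ collect (n ℕ.^ t) n q t d (F es) (W es) ⟩
      n ℕ.* (n ℕ.^ t ℕ.* shifted)
        ≤⟨ ∑-lower _ n (n ℕ.^ t ℕ.* (n ℕ.* q)) after (indicator (U es)) step ⟩
      n ℕ.* ∑ after ℕ.+ n ℕ.^ t ℕ.* (n ℕ.* q) ℕ.* ∑ (indicator (U es))
        ≡⟨ ≡.cong (λ u → n ℕ.* ∑ after ℕ.+ n ℕ.^ t ℕ.* (n ℕ.* q) ℕ.* u) (∑-indicator (U es)) ⟩
      n ℕ.* ∑ after ℕ.+ n ℕ.^ t ℕ.* (n ℕ.* q) ℕ.* ∣ U es ∣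
        ≤⟨ ℕ.+-monoʳ-≤ (n ℕ.* ∑ after) (ℕ.*-monoʳ-≤ (n ℕ.^ t ℕ.* (n ℕ.* q)) (∣U∣≤W es)) ⟩
      n ℕ.* ∑ after ℕ.+ n ℕ.^ t ℕ.* (n ℕ.* q) ℕ.* W es
        ∎)
      where
      open ℕ.≤-Reasoning

      after : Fin n → ℕ
      after e = extensionSum t cost (e ∷ es)

      shifted : ℕ
      -- The potential as if the request opened one facility of empty configuration: `t` requests
      -- remain, and `q + d` is the weight of `W` that belongs to `t`.
      shifted = n ℕ.* q ℕ.* suc (F es) ℕ.+ n ℕ.* q ℕ.* t ℕ.+ (q ℕ.+ d) ℕ.* W es

      collect : ∀ m n q t d f w →
        n ℕ.* m ℕ.* (n ℕ.* q ℕ.* f ℕ.+ n ℕ.* q ℕ.* suc t ℕ.+ d ℕ.* w) ℕ.+ m ℕ.* (n ℕ.* q) ℕ.* w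
        ≡ n ℕ.* (m ℕ.* (n ℕ.* q ℕ.* suc f ℕ.+ n ℕ.* q ℕ.* t ℕ.+ (q ℕ.+ d) ℕ.* w))
      collect = solve-∀

      split : ∀ m k f i u v → m ℕ.* (k ℕ.* (f ℕ.+ i) ℕ.+ u ℕ.+ v)
                            ≡ m ℕ.* (k ℕ.* f ℕ.+ u ℕ.+ v) ℕ.+ m ℕ.* k ℕ.* i
      split = solve-∀

      n≡′ : n ≡ t ℕ.* q ℕ.+ (q ℕ.+ d)
      n≡′ = ≡.trans n≡ (≡.trans (≡.cong (ℕ._+ d) (ℕ.+-comm q (t ℕ.* q))) (ℕ.+-assoc (t ℕ.* q) q d))

      step : ∀ e → n ℕ.^ t ℕ.* shifted
                   ℕ.≤ n ℕ.* after e ℕ.+ n ℕ.^ t ℕ.* (n ℕ.* q) ℕ.* indicator (U es) e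
      step e = begin
        n ℕ.^ t ℕ.* shifted
          ≤⟨ ℕ.*-monoʳ-≤ (n ℕ.^ t) (ℕ.+-mono-≤
               (ℕ.+-monoˡ-≤ (n ℕ.* q ℕ.* t) (ℕ.*-monoʳ-≤ (n ℕ.* q) (F-step es e)))
               (ℕ.*-monoʳ-≤ (q ℕ.+ d) (W-mono es e))) ⟩
        n ℕ.^ t ℕ.* (n ℕ.* q ℕ.* (F (e ∷ es) ℕ.+ indicator (U es) e) ℕ.+ n ℕ.* q ℕ.* t
                     ℕ.+ (q ℕ.+ d) ℕ.* W (e ∷ es))
          ≡⟨ split (n ℕ.^ t) (n ℕ.* q) (F (e ∷ es)) (indicator (U es) e) _ _ ⟩
        n ℕ.^ t ℕ.* potential t (q ℕ.+ d) (e ∷ es)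
          ℕ.+ n ℕ.^ t ℕ.* (n ℕ.* q) ℕ.* indicator (U es) e
          ≤⟨ ℕ.+-monoˡ-≤ _ (extensionSum-lower t (q ℕ.+ d) n≡′ (e ∷ es)) ⟩
        n ℕ.* after e ℕ.+ n ℕ.^ t ℕ.* (n ℕ.* q) ℕ.* indicator (U es) e
          ∎

    -- With `q` random requests the weight of `W` is `n - q * q`, still a natural number by
    -- assumption. Of the potential only the middle term, now `n * q * q`, is kept.
    extensionSum-lower-q : .{{_ : NonZero n}} → q ℕ.* q ℕ.≤ n → ∀ es →
      n ℕ.^ q ℕ.* (q ℕ.* q) ℕ.≤ extensionSum q cost es
    extensionSum-lower-q q²≤n es = ℕ.*-cancelˡ-≤ n (begin
      n ℕ.* (n ℕ.^ q ℕ.* (q ℕ.* q))            ≡⟨ rearrange n (n ℕ.^ q) q ⟩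
      n ℕ.^ q ℕ.* (n ℕ.* q ℕ.* q)              ≤⟨ ℕ.*-monoʳ-≤ (n ℕ.^ q)
        (ℕ.≤-trans (ℕ.m≤n+m _ (n ℕ.* q ℕ.* F es)) (ℕ.m≤m+n _ _)) ⟩
      n ℕ.^ q ℕ.* potential q (n ℕ.∸ q ℕ.* q) es  ≤⟨ extensionSum-lower q _ (≡.sym (ℕ.m+[n∸m]≡n q²≤n)) es ⟩
      n ℕ.* extensionSum q cost es             ∎)
      where
      open ℕ.≤-Reasoning
      rearrange : ∀ n m q → n ℕ.* (m ℕ.* (q ℕ.* q)) ≡ m ℕ.* (n ℕ.* q ℕ.* q)
      rearrange = solve-∀

-- Arithmetic in an ordered field without a decidable order.

module OrderedField (ℝ : RealNumbers c ℓ₁ ℓ₂ ℓ₃) where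
  open RealNumbers ℝ hiding (zero)

  commutativeRing : CommutativeRing c ℓ₁
  commutativeRing = HeytingCommutativeRing.commutativeRing heytingCommutativeRing

  open CommutativeRing commutativeRing public using (ring; semiring; commutativeSemiring)
  open RingProperties ring public using (-0#≈0#; -1*x≈-x)
  open SemiringMult semiring public using (×-homo-+; ×1-homo-*)

  private
    variable
      x y z : Carrier

  <-asym : Asymmetric _<_
  <-asym x<y y<x = <-irrefl refl (<-trans x<y y<x)

  <⇒≤ : x < y → x ≤ y
  <⇒≤ = <-asym

  ≈⇒≤ : x ≈ y → x ≤ y
  ≈⇒≤ x≈y y<x = <-irrefl (sym x≈y) y<x

  -- Cotransitivity splits a supposed `z < x` at `y`, and either half contradicts one of the
  -- hypotheses.
  ≤-trans : x ≤ y → y ≤ z → x ≤ z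
  ≤-trans {y = y} x≤y y≤z z<x with <-cotrans z<x y
  ... | inj₁ z<y = y≤z z<y
  ... | inj₂ y<x = x≤y y<x

  -- Tightness of apartness gives equality, since `x # y` would yield a strict inequality in one of
  -- the two directions.
  ≤-antisym : x ≤ y → y ≤ x → x ≈ y
  ≤-antisym {x} {y} x≤y y≤x = proj₁ (tight x y) x#y⇒⊥
    where
    x#y⇒⊥ : ¬ (x # y)
    x#y⇒⊥ x#y with #⇒<⊎> x#y
    ... | inj₁ x<y = y≤x x<y
    ... | inj₂ y<x = x≤y y<x

  <-≤-trans : x < y → y ≤ z → x < z
  <-≤-trans {z = z} x<y y≤z with <-cotrans x<y z
  ... | inj₁ x<z = x<z
  ... | inj₂ z<y = ⊥-elim (y≤z z<y)

  ≤-<-trans : x ≤ y → y < z → x < z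
  ≤-<-trans {x} x≤y y<z with <-cotrans y<z x
  ... | inj₁ y<x = ⊥-elim (x≤y y<x)
  ... | inj₂ x<z = x<z

  ≤-isPartialOrder : IsPartialOrder _≈_ _≤_
  ≤-isPartialOrder = record
    { isPreorder = record
      { isEquivalence = isEquivalence
      ; reflexive     = ≈⇒≤
      ; trans         = ≤-trans
      }
    ; antisym = ≤-antisym
    }

  module ≤-Reasoning = TripleReasoning
    (IsPartialOrder.isPreorder ≤-isPartialOrder)
    <-asym <-trans (<-respʳ-≈ , <-respˡ-≈) <⇒≤ <-≤-trans ≤-<-trans

  open ≤-Reasoning

  +-cancelʳ-< : ∀ z → x + z < y + z → x < y
  +-cancelʳ-< {x} {y} z x+z<y+z = begin-strict
    x              ≈⟨ cancel x ⟨
    x + z + - z    <⟨ +-monoˡ-< (- z) x+z<y+z ⟩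
    y + z + - z    ≈⟨ cancel y ⟩
    y              ∎
    where
    cancel : ∀ w → w + z + - z ≈ w
    cancel w = trans (+-assoc w z (- z))
                     (trans (+-congˡ (-‿inverseʳ z)) (+-identityʳ w))

  +-monoˡ-≤ : ∀ z → x ≤ y → x + z ≤ y + z
  +-monoˡ-≤ z x≤y y+z<x+z = x≤y (+-cancelʳ-< z y+z<x+z)

  +-monoʳ-≤ : ∀ z → x ≤ y → z + x ≤ z + y
  +-monoʳ-≤ {x} {y} z x≤y = begin
    z + x  ≈⟨ +-comm z x ⟩
    x + z  ≤⟨ +-monoˡ-≤ z x≤y ⟩
    y + z  ≈⟨ +-comm y z ⟩
    z + y  ∎

  +-mono-≤ : ∀ {u v} → x ≤ y → u ≤ v → x + u ≤ y + v
  +-mono-≤ {y = y} {u = u} x≤y u≤v = ≤-trans (+-monoˡ-≤ u x≤y) (+-monoʳ-≤ y u≤v)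

  +-cancelʳ-≤ : ∀ z → x + z ≤ y + z → x ≤ y
  +-cancelʳ-≤ z x+z≤y+z y<x = x+z≤y+z (+-monoˡ-< z y<x)

  *-monoʳ-< : 0# < z → x < y → x * z < y * z
  *-monoʳ-< {z} {x} {y} 0<z x<y = begin-strict
    x * z                  ≈⟨ +-identityˡ (x * z) ⟨
    0# + x * z             <⟨ +-monoˡ-< (x * z) (*-pos 0<y-x 0<z) ⟩
    (y + - x) * z + x * z  ≈⟨ distribʳ z (y + - x) x ⟨
    (y + - x + x) * z      ≈⟨ *-congʳ y-x+x≈y ⟩
    y * z                  ∎
    where
    0<y-x : 0# < y + - x
    0<y-x = <-respˡ-≈ (-‿inverseʳ x) (+-monoˡ-< (- x) x<y)

    y-x+x≈y : y + - x + x ≈ y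
    y-x+x≈y = trans (+-assoc y (- x) x)
                    (trans (+-congˡ (-‿inverseˡ x)) (+-identityʳ y))

  -- Up to double negation z is either 0 or positive, and the goal is negative.
  *-monoʳ-≤ : 0# ≤ z → x ≤ y → x * z ≤ y * z
  *-monoʳ-≤ {z} {x} {y} 0≤z x≤y yz<xz = <-irrefl yz≈xz yz<xz
    where
    z≤0 : z ≤ 0#
    z≤0 0<z = <-irrefl (*-congʳ (≤-antisym y≤x x≤y)) yz<xz
      where
      y≤x : y ≤ x
      y≤x x<y = <-asym yz<xz (*-monoʳ-< 0<z x<y)

    z≈0 : z ≈ 0#
    z≈0 = ≤-antisym z≤0 0≤z

    yz≈xz : y * z ≈ x * z
    yz≈xz = trans (*-congˡ z≈0) (trans (zeroʳ y) (sym (trans (*-congˡ z≈0) (zeroʳ x))))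

  *-monoˡ-≤ : 0# ≤ z → x ≤ y → z * x ≤ z * y
  *-monoˡ-≤ {z} {x} {y} 0≤z x≤y = begin
    z * x  ≈⟨ *-comm z x ⟩
    x * z  ≤⟨ *-monoʳ-≤ 0≤z x≤y ⟩
    y * z  ≈⟨ *-comm y z ⟩
    z * y  ∎

  *-nonneg : 0# ≤ x → 0# ≤ y → 0# ≤ x * y
  *-nonneg {x} {y} 0≤x 0≤y = begin
    0#      ≈⟨ zeroˡ y ⟨
    0# * y  ≤⟨ *-monoʳ-≤ 0≤y 0≤x ⟩
    x * y   ∎

  *-cancelʳ-≤ : 0# < z → x * z ≤ y * z → x ≤ y
  *-cancelʳ-≤ 0<z xz≤yz y<x = xz≤yz (*-monoʳ-< 0<z y<x)

  fromℕ-nonneg : ∀ n → 0# ≤ fromℕ n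
  fromℕ-nonneg zero    = ≈⇒≤ refl
  fromℕ-nonneg (suc n) = <⇒≤ (0<fromℕ-suc n)

  fromℕ-pos : ∀ n .{{_ : NonZero n}} → 0# < fromℕ n
  fromℕ-pos (suc n) = 0<fromℕ-suc n

  fromℕ-mono-≤ : ∀ {m n} → m ℕ.≤ n → fromℕ m ≤ fromℕ n
  fromℕ-mono-≤ {n = n} z≤n = fromℕ-nonneg n
  fromℕ-mono-≤ (s≤s m≤n)   = +-monoʳ-≤ 1# (fromℕ-mono-≤ m≤n)

  fromℕ-+ : ∀ m n → fromℕ (m ℕ.+ n) ≈ fromℕ m + fromℕ n
  fromℕ-+ = ×-homo-+ 1#

  fromℕ-* : ∀ m n → fromℕ (m ℕ.* n) ≈ fromℕ m * fromℕ n
  fromℕ-* = ×1-homo-*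

  /-*-cancel : ∀ x n .{{_ : NonZero n}} → x / n * fromℕ n ≈ x
  /-*-cancel x (suc n) with #⇒invertible (<⊎>⇒# (inj₂ (0<fromℕ-suc n)))
  ... | n⁻¹ , n⁻¹*n≈1 , _ = begin-equality
    x * n⁻¹ * fromℕ (suc n)           ≈⟨ *-assoc x n⁻¹ (fromℕ (suc n)) ⟩
    -- The field axiom inverts the difference witnessing apartness from 0, so the subtraction of 0
    -- has to be inserted.
    x * (n⁻¹ * fromℕ (suc n))         ≈⟨ *-congˡ (*-congˡ n-0≈n) ⟨
    x * (n⁻¹ * (fromℕ (suc n) - 0#))  ≈⟨ *-congˡ n⁻¹*n≈1 ⟩
    x * 1#                            ≈⟨ *-identityʳ x ⟩
    x                                 ∎
    where
    n-0≈n : fromℕ (suc n) - 0# ≈ fromℕ (suc n)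
    n-0≈n = trans (+-congˡ -0#≈0#) (+-identityʳ _)

  /-mono-≤ : ∀ m n .{{_ : NonZero m}} .{{_ : NonZero n}} →
             x * fromℕ n ≤ y * fromℕ m → x / m ≤ y / n
  /-mono-≤ {x} {y} m n xn≤ym = *-cancelʳ-≤ (*-pos (fromℕ-pos m) (fromℕ-pos n)) (begin
    x / m * (fromℕ m * fromℕ n)  ≈⟨ *-assoc (x / m) (fromℕ m) (fromℕ n) ⟨
    x / m * fromℕ m * fromℕ n    ≈⟨ *-congʳ (/-*-cancel x m) ⟩
    x * fromℕ n                  ≤⟨ xn≤ym ⟩
    y * fromℕ m                  ≈⟨ *-congʳ (/-*-cancel y n) ⟨
    y / n * fromℕ n * fromℕ m    ≈⟨ *-assoc (y / n) (fromℕ n) (fromℕ m) ⟩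
    y / n * (fromℕ n * fromℕ m)  ≈⟨ *-congˡ (*-comm (fromℕ n) (fromℕ m)) ⟩
    y / n * (fromℕ m * fromℕ n)  ∎)

  -- By cotransitivity, if x + n x is positive then so is x or n x.
  positive-multiple : ∀ n → 0# < fromℕ n * x → 0# < x
  positive-multiple {x} zero    0<0x = ⊥-elim (<-irrefl (sym (zeroˡ x)) 0<0x)
  positive-multiple {x} (suc n) 0<[1+n]x with <-cotrans 0<[1+n]x x
  ... | inj₁ 0<x = 0<x
  ... | inj₂ x<[1+n]x = positive-multiple n (+-cancelʳ-< x (begin-strict
    0# + x              ≈⟨ +-identityˡ x ⟩
    x                   <⟨ x<[1+n]x ⟩
    (1# + fromℕ n) * x  ≈⟨ distribʳ x 1# (fromℕ n) ⟩
    1# * x + fromℕ n * x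
                        ≈⟨ +-comm _ _ ⟩
    fromℕ n * x + 1# * x
                        ≈⟨ +-congˡ (*-identityˡ x) ⟩
    fromℕ n * x + x     ∎))

  -- As `≤` is a negation, `m < r` may be assumed, and then `s ≤ m * m < r * m ≤ r * r ≈ s`.
  sqrt≤ : ∀ {r s m} .{{_ : NonZero m}} → IsSqrt r (fromℕ s) → s ℕ.≤ m ℕ.* m → r ≤ fromℕ m
  sqrt≤ {r} {s} {m} (0≤r , r*r≈s) s≤m*m m<r = <-irrefl refl (begin-strict
    fromℕ s            ≤⟨ fromℕ-mono-≤ s≤m*m ⟩
    fromℕ (m ℕ.* m)    ≈⟨ fromℕ-* m m ⟩
    fromℕ m * fromℕ m  <⟨ *-monoʳ-< (fromℕ-pos m) m<r ⟩
    r * fromℕ m        ≤⟨ *-monoˡ-≤ 0≤r (<⇒≤ m<r) ⟩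
    r * r              ≈⟨ r*r≈s ⟩
    fromℕ s            ∎)

-- Expectations and upper bounds on means.

module Expectation {ℝ : RealNumbers c ℓ₁ ℓ₂ ℓ₃} (P : ProbabilitySpace ℝ o p) where
  open RealNumbers ℝ hiding (zero)
  open OrderedField ℝ
  open ≤-Reasoning
  open ProbabilitySpace P

  private
    variable
      X Y : Ω → Carrier
      x y : Carrier

  -- Positivity of the expectation is applied to `Y - X`, written with the scalar `- 1#` so that
  -- closure under sums and multiples makes it integrable.
  𝔼-mono : ∀ i j → (∀ ω → X ω ≤ Y ω) → 𝔼 X i ≤ 𝔼 Y j
  𝔼-mono {X} {Y} i j X≤Y = +-cancelʳ-≤ (- 𝔼 X i) (begin
    𝔼 X i + - 𝔼 X i                      ≈⟨ -‿inverseʳ (𝔼 X i) ⟩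
    0#                                   ≤⟨ 𝔼-pos k 0≤Y-X ⟩
    𝔼 (λ ω → Y ω + - 1# * X ω) k         ≈⟨ 𝔼-+ j (integrable-* (- 1#) i) k ⟩
    𝔼 Y j + 𝔼 (λ ω → - 1# * X ω) _       ≈⟨ +-congˡ (𝔼-* (- 1#) i _) ⟩
    𝔼 Y j + - 1# * 𝔼 X i                 ≈⟨ +-congˡ (-1*x≈-x (𝔼 X i)) ⟩
    𝔼 Y j + - 𝔼 X i                      ∎)
    where
    k : Integrable (λ ω → Y ω + - 1# * X ω)
    k = integrable-+ j (integrable-* (- 1#) i)

    0≤Y-X : ∀ ω → 0# ≤ Y ω + - 1# * X ω
    0≤Y-X ω = begin
      0#                 ≈⟨ -‿inverseʳ (X ω) ⟨
      X ω + - X ω        ≤⟨ +-monoˡ-≤ (- X ω) (X≤Y ω) ⟩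
      Y ω + - X ω        ≈⟨ +-congˡ (-1*x≈-x (X ω)) ⟨
      Y ω + - 1# * X ω   ∎

  -- The factor `1#` presents the constant as a multiple of the normalised variable.
  𝔼-const : ∀ x i → 𝔼 (λ _ → x * 1#) i ≈ x
  𝔼-const x i = trans (𝔼-* x (integrable-const 1#) i)
                      (trans (*-congˡ (𝔼-1 _)) (*-identityʳ x))

  -- Integrability travels with the bound, exactly as competitiveness supplies it.
  Mean≤ : (Ω → Carrier) → Carrier → Set _
  Mean≤ X x = Σ[ i ∈ Integrable X ] 𝔼 X i ≤ x

  mean≤-resp : (∀ ω → X ω ≈ Y ω) → x ≤ y → Mean≤ X x → Mean≤ Y y
  mean≤-resp X≈Y x≤y (i , 𝔼X≤x) =
    integrable-resp X≈Y i ,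
    ≤-trans (𝔼-mono _ i (λ ω → ≈⇒≤ (sym (X≈Y ω)))) (≤-trans 𝔼X≤x x≤y)

  mean≤-+ : Mean≤ X x → Mean≤ Y y → Mean≤ (λ ω → X ω + Y ω) (x + y)
  mean≤-+ (i , 𝔼X≤x) (j , 𝔼Y≤y) =
    integrable-+ i j , ≤-trans (≈⇒≤ (𝔼-+ i j _)) (+-mono-≤ 𝔼X≤x 𝔼Y≤y)

  mean≤-0 : Mean≤ (λ _ → 0#) 0#
  mean≤-0 = mean≤-resp (λ _ → zeroˡ 1#) (≈⇒≤ refl)
    (integrable-const _ , ≈⇒≤ (𝔼-const 0# _))

  mean≤-sum : ∀ {n} (X : Fin n → Ω → Carrier) → (∀ e → Mean≤ (X e) x) →
              Mean≤ (λ ω → sum (λ e → X e ω)) (fromℕ n * x)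
  mean≤-sum {x} {zero}  X X≤x = mean≤-resp (λ _ → refl) (≈⇒≤ (sym (zeroˡ x))) mean≤-0
  mean≤-sum {x} {suc n} X X≤x = mean≤-resp (λ _ → refl) (≈⇒≤ x+nx≈[1+n]x)
    (mean≤-+ (X≤x zero) (mean≤-sum (λ e → X (suc e)) (λ e → X≤x (suc e))))
    where
    x+nx≈[1+n]x : x + fromℕ n * x ≈ fromℕ (suc n) * x
    x+nx≈[1+n]x = sym (trans (distribʳ x 1# (fromℕ n)) (+-congʳ (*-identityˡ x)))

  -- The easy half of Yao's principle: what every deterministic strategy must pay, the randomized
  -- one pays in expectation.
  lower≤mean : (∀ ω → y ≤ X ω) → Mean≤ X x → y ≤ x
  lower≤mean {y} {X} {x} y≤X (i , 𝔼X≤x) = begin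
    y                   ≈⟨ 𝔼-const y (integrable-const _) ⟨
    𝔼 (λ _ → y * 1#) _  ≤⟨ 𝔼-mono _ i (λ ω → ≤-trans (≈⇒≤ (*-identityʳ y)) (y≤X ω)) ⟩
    𝔼 X i               ≤⟨ 𝔼X≤x ⟩
    x                   ∎

-- The single-point environment and its costs.

module HardInstance (ℝ : RealNumbers c ℓ₁ ℓ₂ ℓ₃) (s : ℕ) .{{_ : NonZero s}}
                    (k : RealNumbers.Carrier ℝ) (0≤k : RealNumbers._≤_ ℝ (RealNumbers.0# ℝ) k)
                    (q : ℕ) where
  open RealNumbers ℝ hiding (zero)
  open OrderedField ℝ
  open ≤-Reasoning
  open OMFLP ℝ s

  scaled-mono : ∀ {m n} → m ℕ.≤ n → k * fromℕ m ≤ k * fromℕ n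
  scaled-mono m≤n = *-monoˡ-≤ 0≤k (fromℕ-mono-≤ m≤n)

  scaled-+ : ∀ m n → k * fromℕ (m ℕ.+ n) ≈ k * fromℕ m + k * fromℕ n
  scaled-+ m n = trans (*-congˡ (fromℕ-+ m n)) (distribˡ k (fromℕ m) (fromℕ n))

  scaled-* : ∀ m n → k * fromℕ m * fromℕ n ≈ k * fromℕ (m ℕ.* n)
  scaled-* m n = trans (*-assoc k (fromℕ m) (fromℕ n)) (*-congˡ (sym (fromℕ-* m n)))

  environment : Environment
  environment = record
    { size     = 1
    ; d        = λ _ _ → 0#
    ; isMetric = zeroMetric
    ; f        = λ _ σ → k * fromℕ (q ℕ.+ ∣ σ ∣)
    ; f-nonneg = λ _ σ → *-nonneg 0≤k (fromℕ-nonneg (q ℕ.+ ∣ σ ∣))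
    ; f-subadd = λ _ → subadditive
    ; f-share  = λ _ σ → /-mono-≤ s ∣ σ ∣ (share σ)
    }
    where
    zeroMetric : IsGeneralMetric {A = Fin 1} _≡_ _≈_ _≤_ 0# _+_ (λ _ _ → 0#)
    zeroMetric = record
      { isSemiMetric = record
        { isQuasiSemiMetric = record
          { isPreMetric = record
            { isProtoMetric = record
              { isPartialOrder  = ≤-isPartialOrder
              ; ≈-isEquivalence = ≡.isEquivalence
              ; cong            = λ _ _ → refl
              ; nonNegative     = ≈⇒≤ refl
              }
            ; ≈⇒0 = λ _ → refl
            }
          ; 0⇒≈ = λ { {zero} {zero} _ → ≡.refl }
          }
        ; sym = λ _ _ → refl
        }
      ; triangle = λ _ _ _ → ≈⇒≤ (sym (+-identityˡ 0#))
      }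

    subadditive : ∀ a b → k * fromℕ (q ℕ.+ ∣ a ∪ b ∣)
                          ≤ k * fromℕ (q ℕ.+ ∣ a ∣) + k * fromℕ (q ℕ.+ ∣ b ∣)
    subadditive a b = ≤-trans (scaled-mono q+∣a∪b∣≤) (≈⇒≤ (scaled-+ (q ℕ.+ ∣ a ∣) (q ℕ.+ ∣ b ∣)))
      where
      q+∣a∪b∣≤ : q ℕ.+ ∣ a ∪ b ∣ ℕ.≤ (q ℕ.+ ∣ a ∣) ℕ.+ (q ℕ.+ ∣ b ∣)
      q+∣a∪b∣≤ = ℕ.≤-trans
        (ℕ.+-monoʳ-≤ q (ℕ.≤-trans (∣p∪q∣≤∣p∣+∣q∣ a b) (ℕ.+-monoʳ-≤ ∣ a ∣ (ℕ.m≤n+m ∣ b ∣ q))))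
        (ℕ.≤-reflexive (≡.sym (ℕ.+-assoc q ∣ a ∣ (q ℕ.+ ∣ b ∣))))

    -- The cost per commodity is `k * (q / ∣ σ ∣ + 1)`, which is least for the full set.
    share : ∀ σ → k * fromℕ (q ℕ.+ ∣ ⊤ {s} ∣) * fromℕ ∣ σ ∣ ≤ k * fromℕ (q ℕ.+ ∣ σ ∣) * fromℕ s
    share σ = begin
      k * fromℕ (q ℕ.+ ∣ ⊤ {s} ∣) * fromℕ ∣ σ ∣  ≈⟨ scaled-* (q ℕ.+ ∣ ⊤ {s} ∣) ∣ σ ∣ ⟩
      k * fromℕ ((q ℕ.+ ∣ ⊤ {s} ∣) ℕ.* ∣ σ ∣)    ≤⟨ scaled-mono crossMultiplied ⟩
      k * fromℕ ((q ℕ.+ ∣ σ ∣) ℕ.* s)            ≈⟨ scaled-* (q ℕ.+ ∣ σ ∣) s ⟨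
      k * fromℕ (q ℕ.+ ∣ σ ∣) * fromℕ s          ∎
      where
      crossMultiplied : (q ℕ.+ ∣ ⊤ {s} ∣) ℕ.* ∣ σ ∣ ℕ.≤ (q ℕ.+ ∣ σ ∣) ℕ.* s
      crossMultiplied rewrite Subset.∣⊤∣≡n s | ℕ.*-distribʳ-+ ∣ σ ∣ q s | ℕ.*-distribʳ-+ s q ∣ σ ∣ =
        ℕ.+-mono-≤ (ℕ.*-monoʳ-≤ q (Subset.∣p∣≤n σ)) (ℕ.≤-reflexive (ℕ.*-comm s ∣ σ ∣))

  Req Fac : Set
  Req = Request environment
  Fac = Facility environment

  request : Fin s → Req
  request e = record { location = zero ; demand = ⁅ e ⁆ ; nonempty = e , Subset.x∈⁅x⁆ e }

  totalSize : List Fac → ℕ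
  totalSize []       = 0
  totalSize (φ ∷ φs) = ∣ config φ ∣ ℕ.+ totalSize φs

  covered : List Fac → Subset s
  covered []       = ⊥
  covered (φ ∷ φs) = config φ ∪ covered φs

  -- Construction cost in units of `k`, which moves all counting into the naturals.
  weight : List Fac → ℕ
  weight φs = q ℕ.* length φs ℕ.+ totalSize φs

  ∣covered∣≤totalSize : ∀ φs → ∣ covered φs ∣ ℕ.≤ totalSize φs
  ∣covered∣≤totalSize []       = ℕ.≤-reflexive (Subset.∣⊥∣≡0 s)
  ∣covered∣≤totalSize (φ ∷ φs) = ℕ.≤-trans (∣p∪q∣≤∣p∣+∣q∣ (config φ) (covered φs))
    (ℕ.+-monoʳ-≤ ∣ config φ ∣ (∣covered∣≤totalSize φs))

  totalSize-++ : ∀ φs ψs → totalSize (φs ++ ψs) ≡ totalSize φs ℕ.+ totalSize ψs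
  totalSize-++ []       ψs = ≡.refl
  totalSize-++ (φ ∷ φs) ψs = ≡.trans (≡.cong (∣ config φ ∣ ℕ.+_) (totalSize-++ φs ψs))
    (≡.sym (ℕ.+-assoc ∣ config φ ∣ (totalSize φs) (totalSize ψs)))

  weight-++ : ∀ φs ψs → weight (φs ++ ψs) ≡ weight φs ℕ.+ weight ψs
  weight-++ φs ψs rewrite List.length-++ φs {ψs} | totalSize-++ φs ψs =
    rearrange q (length φs) (length ψs) (totalSize φs) (totalSize ψs)
    where
    rearrange : ∀ q l l′ m m′ → q ℕ.* (l ℕ.+ l′) ℕ.+ (m ℕ.+ m′) ≡ q ℕ.* l ℕ.+ m ℕ.+ (q ℕ.* l′ ℕ.+ m′)
    rearrange = solve-∀

  config⊆covered : ∀ φs j → config (List.lookup φs j) ⊆ covered φs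
  config⊆covered (φ ∷ φs) zero    x∈φ = Subset.p⊆p∪q (covered φs) x∈φ
  config⊆covered (φ ∷ φs) (suc j) x∈φ = Subset.q⊆p∪q (config φ) (covered φs) (config⊆covered φs j x∈φ)

  serves⇒∈covered : ∀ φs {A} e → Serves φs A (request e) → e ∈ covered φs
  serves⇒∈covered φs e serves with serves e (Subset.x∈⁅x⁆ e)
  ... | j , _ , e∈φⱼ = config⊆covered φs j e∈φⱼ

  constructionCost≈ : ∀ (φs : List Fac) → constructionCost φs ≈ k * fromℕ (weight φs)
  constructionCost≈ [] = sym (trans
    (*-congˡ (reflexive (≡.cong (λ m → fromℕ (m ℕ.+ 0)) (ℕ.*-zeroʳ q)))) (zeroʳ k))
  constructionCost≈ (φ ∷ φs) = begin-equality
    k * fromℕ (q ℕ.+ ∣ config φ ∣) + constructionCost φs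
      ≈⟨ +-congˡ (constructionCost≈ φs) ⟩
    k * fromℕ (q ℕ.+ ∣ config φ ∣) + k * fromℕ (weight φs)
      ≈⟨ scaled-+ (q ℕ.+ ∣ config φ ∣) (weight φs) ⟨
    k * fromℕ ((q ℕ.+ ∣ config φ ∣) ℕ.+ weight φs)
      ≡⟨ ≡.cong (λ m → k * fromℕ m) (rearrange q (length φs) ∣ config φ ∣ (totalSize φs)) ⟩
    k * fromℕ (weight (φ ∷ φs))
      ∎
    where
    rearrange : ∀ q l m n → (q ℕ.+ m) ℕ.+ (q ℕ.* l ℕ.+ n) ≡ q ℕ.* suc l ℕ.+ (m ℕ.+ n)
    rearrange = solve-∀

  sum≈0 : ∀ {n} (g : Fin n → Carrier) → (∀ i → g i ≈ 0#) → sum g ≈ 0#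
  sum≈0 {zero}  g g≈0 = refl
  sum≈0 {suc n} g g≈0 =
    trans (+-cong (g≈0 zero) (sum≈0 (λ i → g (suc i)) (λ i → g≈0 (suc i)))) (+-identityˡ 0#)

  assignmentCost≈0 : ∀ (φs : List Fac) A r → assignmentCost φs A r ≈ 0#
  assignmentCost≈0 φs A r = sum≈0 _ summand≈0
    where
    summand≈0 : ∀ j → (if Vec.lookup A j then 0# else 0#) ≈ 0#
    summand≈0 j with Vec.lookup A j
    ... | true  = refl
    ... | false = refl

  -- The offline optimum.

  support : List (Fin s) → Subset s
  support []       = ⊥
  support (e ∷ es) = ⁅ e ⁆ ∪ support es

  ∣support∣-∷ : ∀ e es → ∣ support (e ∷ es) ∣ ℕ.≤ suc ∣ support es ∣
  ∣support∣-∷ e es = ℕ.≤-trans (∣p∪q∣≤∣p∣+∣q∣ ⁅ e ⁆ (support es))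
    (ℕ.≤-reflexive (≡.cong (ℕ._+ ∣ support es ∣) (Subset.∣⁅x⁆∣≡1 e)))

  ∣support-replicate∣ : ∀ m e → ∣ support (replicate m e) ∣ ℕ.≤ 1
  ∣support-replicate∣ m e = ℕ.≤-trans (Subset.p⊆q⇒∣p∣≤∣q∣ (⊆⁅e⁆ m))
    (ℕ.≤-reflexive (Subset.∣⁅x⁆∣≡1 e))
    where
    ⊆⁅e⁆ : ∀ m → support (replicate m e) ⊆ ⁅ e ⁆
    ⊆⁅e⁆ zero    x∈⊥ = ⊥-elim (Subset.∉⊥ x∈⊥)
    ⊆⁅e⁆ (suc m) x∈∪ with Subset.x∈p∪q⁻ ⁅ e ⁆ (support (replicate m e)) x∈∪
    ... | inj₁ x∈⁅e⁆ = x∈⁅e⁆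
    ... | inj₂ x∈    = ⊆⁅e⁆ m x∈

  demand⊆support : ∀ es i → demand (List.lookup (List.map request es) i) ⊆ support es
  demand⊆support (e ∷ es) zero    x∈ = Subset.p⊆p∪q (support es) x∈
  demand⊆support (e ∷ es) (suc i) x∈ = Subset.q⊆p∪q ⁅ e ⁆ (support es) (demand⊆support es i x∈)

  support⊆ : ∀ es {p} → (∀ i → demand (List.lookup (List.map request es) i) ⊆ p) → support es ⊆ p
  support⊆ []       demand⊆p x∈⊥ = ⊥-elim (Subset.∉⊥ x∈⊥)
  support⊆ (e ∷ es) demand⊆p x∈∪ with Subset.x∈p∪q⁻ ⁅ e ⁆ (support es) x∈∪
  ... | inj₁ x∈⁅e⁆ = demand⊆p zero x∈⁅e⁆
  ... | inj₂ x∈    = support⊆ es (λ i → demand⊆p (suc i)) x∈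

  offlineCost≈ : ∀ {rs} (sol : OfflineSolution rs) →
    OfflineSolution.cost sol ≈ k * fromℕ (weight (OfflineSolution.facilities sol))
  offlineCost≈ {rs} sol = trans
    (+-cong (constructionCost≈ facilities)
            (sum≈0 _ (λ i → assignmentCost≈0 facilities (assign i) (List.lookup rs i))))
    (+-identityʳ _)
    where open OfflineSolution sol

  -- Buying the whole support at once pays `q` once. Any solution needs some facility, and the sizes
  -- of its configurations add up to at least the support. Without requests nothing would be bought,
  -- hence the nonempty sequence.
  opt : ∀ e es → IsOPT (List.map request (e ∷ es)) (k * fromℕ (q ℕ.+ ∣ support (e ∷ es) ∣))
  opt e es = (one , trans (offlineCost≈ one) (*-congˡ (reflexive (≡.cong fromℕ weight-one)))) , optimal
    where
    rs : List Req
    rs = List.map request (e ∷ es)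

    one : OfflineSolution rs
    one = record
      { facilities = record { point = zero ; config = support (e ∷ es) } ∷ []
      ; assign     = λ _ → ⊤
      ; serves     = λ i x x∈ → zero , Subset.∈⊤ , demand⊆support (e ∷ es) i x∈
      }

    weight-one : q ℕ.* 1 ℕ.+ (∣ support (e ∷ es) ∣ ℕ.+ 0) ≡ q ℕ.+ ∣ support (e ∷ es) ∣
    weight-one = ≡.cong₂ ℕ._+_ (ℕ.*-identityʳ q) (ℕ.+-identityʳ _)

    optimal : ∀ (sol : OfflineSolution rs) →
              k * fromℕ (q ℕ.+ ∣ support (e ∷ es) ∣) ≤ OfflineSolution.cost sol
    optimal sol = ≤-trans (scaled-mono (ℕ.+-mono-≤ (q≤ facilities e∈) ∣support∣≤))
                          (≈⇒≤ (sym (offlineCost≈ sol)))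
      where
      open OfflineSolution sol

      support⊆covered : support (e ∷ es) ⊆ covered facilities
      support⊆covered = support⊆ (e ∷ es) λ i {x} x∈ →
        let (j , _ , x∈φⱼ) = serves i x x∈ in config⊆covered facilities j x∈φⱼ

      ∣support∣≤ : ∣ support (e ∷ es) ∣ ℕ.≤ totalSize facilities
      ∣support∣≤ = ℕ.≤-trans (Subset.p⊆q⇒∣p∣≤∣q∣ support⊆covered) (∣covered∣≤totalSize facilities)

      e∈ : e ∈ covered facilities
      e∈ = serves⇒∈covered facilities e (serves zero)

      q≤ : ∀ φs → e ∈ covered φs → q ℕ.≤ q ℕ.* length φs
      q≤ []       e∈⊥ = ⊥-elim (Subset.∉⊥ e∈⊥)
      q≤ (φ ∷ φs) _   = ℕ.m≤m*n q (suc (length φs))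

  -- The cost of a deterministic online strategy.

  module _ (strategy : Strategy environment) where
    open Strategy strategy

    opened : List (Fin s) → List Fac
    opened es = allOpened opens (List.map request es)

    onlineWeight : List (Fin s) → ℕ
    onlineWeight es = weight (opened es)

    onlineCost≈ : ∀ es → cost (List.map request es) ≈ k * fromℕ (onlineWeight es)
    onlineCost≈ []       = constructionCost≈ []
    onlineCost≈ (e ∷ es) = begin-equality
      cost rs + (constructionCost new + assignmentCost (allOpened opens (r ∷ rs)) (assign rs r) r)
        ≈⟨ +-cong (onlineCost≈ es) (trans (+-cong (constructionCost≈ new)
             (assignmentCost≈0 (allOpened opens (r ∷ rs)) (assign rs r) r)) (+-identityʳ _)) ⟩
      k * fromℕ (onlineWeight es) + k * fromℕ (weight new)
        ≈⟨ +-comm _ _ ⟩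
      k * fromℕ (weight new) + k * fromℕ (onlineWeight es)
        ≈⟨ scaled-+ (weight new) (onlineWeight es) ⟨
      k * fromℕ (weight new ℕ.+ onlineWeight es)
        ≡⟨ ≡.cong (λ m → k * fromℕ m) (weight-++ new (opened es)) ⟨
      k * fromℕ (onlineWeight (e ∷ es))
        ∎
      where
      r : Req
      r = request e

      rs : List Req
      rs = List.map request es

      new : List Fac
      new = opens rs r

    -- After arrival `e` must be covered. If nothing was opened it was covered before, and the
    -- indicator is 1. The helper `go` generalises over the new facilities to allow this case split.
    newFacilityUnlessCovered : ∀ es e →
      suc (length (opened es)) ℕ.≤ length (opened (e ∷ es)) ℕ.+ indicator (covered (opened es)) e
    newFacilityUnlessCovered es e = go (opens (List.map request es) (request e))
      (serves⇒∈covered (opened (e ∷ es)) e (serves (List.map request es) (request e)))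
      where
      go : ∀ new → e ∈ covered (new ++ opened es) →
           suc (length (opened es)) ℕ.≤ length (new ++ opened es) ℕ.+ indicator (covered (opened es)) e
      go [] e∈ rewrite []=⇒lookup e∈ = ℕ.≤-reflexive (ℕ.+-comm 1 _)
      go (φ ∷ new) _ = s≤s (ℕ.≤-trans (ℕ.≤-trans (ℕ.m≤n+m _ (length new))
        (ℕ.≤-reflexive (≡.sym (List.length-++ new)))) (ℕ.m≤m+n _ _))

    onlineWeight-lower : q ℕ.* q ℕ.≤ s → ∀ es →
      s ℕ.^ q ℕ.* (q ℕ.* q) ℕ.≤ extensionSum q onlineWeight es
    onlineWeight-lower = extensionSum-lower-q q
      (λ es → length (opened es)) (λ es → totalSize (opened es)) (λ es → covered (opened es))
      (λ es → ∣covered∣≤totalSize (opened es))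
      (λ es e → ℕ.≤-trans (ℕ.m≤n+m _ _)
        (ℕ.≤-reflexive (≡.sym (totalSize-++ (opens (List.map request es) (request e)) (opened es)))))
      newFacilityUnlessCovered

-- Averaging a competitive algorithm over the random requests.

module LowerBound (ℝ : RealNumbers c ℓ₁ ℓ₂ ℓ₃) (s : ℕ) .{{_ : NonZero s}}
                  (A : OMFLP.RandomizedAlgorithm ℝ s o p) where
  open RealNumbers ℝ hiding (zero)
  open OrderedField ℝ
  open ≤-Reasoning
  open OMFLP ℝ s
  open RandomizedAlgorithm A
  open Expectation space

  scaled-∑ : ∀ {n} k (g : Fin n → ℕ) → k * fromℕ (∑ g) ≈ sum (λ e → k * fromℕ (g e))
  scaled-∑ {zero}  k g = zeroʳ k
  scaled-∑ {suc n} k g = begin-equality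
    k * fromℕ (g zero ℕ.+ ∑ g′)           ≈⟨ *-congˡ (fromℕ-+ (g zero) (∑ g′)) ⟩
    k * (fromℕ (g zero) + fromℕ (∑ g′))   ≈⟨ distribˡ k _ _ ⟩
    k * fromℕ (g zero) + k * fromℕ (∑ g′) ≈⟨ +-congˡ (scaled-∑ k g′) ⟩
    sum (λ e → k * fromℕ (g e))           ∎
    where
    g′ : Fin n → ℕ
    g′ e = g (suc e)

  -- Linearity exchanges the sum over the `s ^ t` continuations with the expectation over `ω`. The
  -- invariant `P t es`, with `t` requests still to come, restricts the bound `x` to the sequences
  -- where it is available.
  mean≤-extensionSum : ∀ {ℓ} (P : ℕ → List (Fin s) → Set ℓ) (g : Ω → List (Fin s) → ℕ) {k x} →
    (∀ {t es} e → P (suc t) es → P t (e ∷ es)) →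
    (∀ es → P 0 es → Mean≤ (λ ω → k * fromℕ (g ω es)) x) →
    ∀ t es → P t es → Mean≤ (λ ω → k * fromℕ (extensionSum t (g ω) es)) (fromℕ (s ℕ.^ t) * x)
  mean≤-extensionSum P g {k} {x} step base zero es P₀ =
    mean≤-resp (λ _ → refl) (≈⇒≤ (sym (trans (*-congʳ (+-identityʳ 1#)) (*-identityˡ x)))) (base es P₀)
  mean≤-extensionSum P g {k} {x} step base (suc t) es Pₜ₊₁ =
    mean≤-resp (λ ω → sym (scaled-∑ k (λ e → extensionSum t (g ω) (e ∷ es)))) (≈⇒≤ power)
      (mean≤-sum _ (λ e → mean≤-extensionSum P g step base t (e ∷ es) (step e Pₜ₊₁)))
    where
    power : fromℕ s * (fromℕ (s ℕ.^ t) * x) ≈ fromℕ (s ℕ.^ suc t) * x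
    power = trans (sym (*-assoc (fromℕ s) (fromℕ (s ℕ.^ t)) x))
                  (*-congʳ (sym (fromℕ-* s (s ℕ.^ t))))

  -- n requests, of which the first n ∸ q repeat one commodity, so that the
  -- bound holds at every length n ≥ q, and the last q are uniformly random.
  averageCostBound : ∀ {ratio : ℕ → Carrier} {a} → (∀ E → SinglePoint E → ∀ (rs : List (Request E)) opt → IsOPT rs opt →
      Σ[ i ∈ Integrable (cost E rs) ] 𝔼 (cost E rs) i ≤ ratio (length rs) * opt + a) →
    ∀ {k} → 0# ≤ k → ∀ q n .{{_ : NonZero q}} → q ℕ.* q ℕ.≤ s → q ℕ.≤ n →
    ∀ {ρ} → 0# ≤ ρ → ratio n ≤ ρ →
    k * fromℕ (q ℕ.* q) ≤ ρ * (k * fromℕ (3 ℕ.* q)) + a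
  averageCostBound {ratio} {a} competitive {k} 0≤k q n q²≤s q≤n {ρ} 0≤ρ ratio≤ρ =
    *-cancelʳ-≤ (fromℕ-pos (s ℕ.^ q) {{ℕ.m^n≢0 s q}}) (begin
      k * fromℕ (q ℕ.* q) * fromℕ (s ℕ.^ q)  ≈⟨ scaled-* (q ℕ.* q) (s ℕ.^ q) ⟩
      k * fromℕ (q ℕ.* q ℕ.* s ℕ.^ q)        ≡⟨ ≡.cong (λ m → k * fromℕ m) (ℕ.*-comm (q ℕ.* q) (s ℕ.^ q)) ⟩
      -- The total over all continuations is bounded below for each `ω`, and its mean is bounded
      -- above sequence by sequence.
      k * fromℕ (s ℕ.^ q ℕ.* (q ℕ.* q))      ≤⟨ lower≤mean
        (λ ω → scaled-mono (onlineWeight-lower (strategy ω environment) q²≤s prefix))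
        (mean≤-extensionSum Reachable weightOf (λ {t} {es} → step {t} {es}) base q prefix reachable-prefix) ⟩
      fromℕ (s ℕ.^ q) * bound                ≈⟨ *-comm _ _ ⟩
      bound * fromℕ (s ℕ.^ q)                ∎)
    where
    open HardInstance ℝ s k 0≤k q

    bound : Carrier
    bound = ρ * (k * fromℕ (3 ℕ.* q)) + a

    weightOf : Ω → List (Fin s) → ℕ
    weightOf ω = onlineWeight (strategy ω environment)

    -- The final length is exactly `n`. At most `q + 1` commodities occur in the end: one from the
    -- prefix and one for each random request.
    Reachable : ℕ → List (Fin s) → Set
    Reachable t es = length es ℕ.+ t ≡ n × ∣ support es ∣ ℕ.+ t ℕ.≤ suc q

    step : ∀ {t es} e → Reachable (suc t) es → Reachable t (e ∷ es)
    step {t} {es} e (len , supp) =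
      ≡.trans (≡.sym (ℕ.+-suc (length es) t)) len ,
      ℕ.≤-trans (ℕ.+-monoˡ-≤ t (∣support∣-∷ e es))
        (ℕ.≤-trans (ℕ.≤-reflexive (≡.sym (ℕ.+-suc ∣ support es ∣ t))) supp)

    first : Fin s
    first = fromNonZero s
      where
      fromNonZero : ∀ m .{{_ : NonZero m}} → Fin m
      fromNonZero (suc m) = zero

    prefix : List (Fin s)
    prefix = replicate (n ℕ.∸ q) first

    reachable-prefix : Reachable q prefix
    reachable-prefix =
      ≡.trans (≡.cong (ℕ._+ q) (List.length-replicate (n ℕ.∸ q))) (ℕ.m∸n+n≡m q≤n) ,
      ℕ.+-monoˡ-≤ q (∣support-replicate∣ (n ℕ.∸ q) first)

    base : ∀ es → Reachable 0 es → Mean≤ (λ ω → k * fromℕ (weightOf ω es)) bound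
    -- The formula for the optimum requires a request; there is one because `n ≥ q > 0`.
    base [] (0≡n , _) = ⊥-elim (ℕ.<⇒≱ (ℕ.>-nonZero⁻¹ q) (ℕ.≤-trans q≤n (ℕ.≤-reflexive (≡.sym 0≡n))))
    base (e ∷ es) (len , supp) =
      mean≤-resp (λ ω → onlineCost≈ (strategy ω environment) (e ∷ es)) ratio*opt+a≤bound
        (competitive environment ≡.refl (List.map request (e ∷ es)) _ (opt e es))
      where
      m : ℕ
      m = q ℕ.+ ∣ support (e ∷ es) ∣

      m≤3q : m ℕ.≤ 3 ℕ.* q
      -- The support has at most `q + 1 ≤ 2 * q` elements, as `q` is positive.
      m≤3q = ℕ.+-monoʳ-≤ q (ℕ.≤-trans (ℕ.m≤m+n _ 0) (ℕ.≤-trans supp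
        (ℕ.+-mono-≤ (ℕ.>-nonZero⁻¹ q) (ℕ.m≤m+n q 0))))

      length≡n : length (List.map request (e ∷ es)) ≡ n
      length≡n = ≡.trans (List.length-map request (e ∷ es)) (≡.trans (≡.sym (ℕ.+-identityʳ _)) len)

      ratio*opt+a≤bound : ratio (length (List.map request (e ∷ es))) * (k * fromℕ m) + a ≤ bound
      ratio*opt+a≤bound = +-monoˡ-≤ a (begin
        ratio (length (List.map request (e ∷ es))) * (k * fromℕ m)
          ≡⟨ ≡.cong (λ l → ratio l * (k * fromℕ m)) length≡n ⟩
        -- The sign of `ratio n` is unknown, so it is replaced by the nonnegative `ρ` before the
        -- optimum is enlarged.
        ratio n * (k * fromℕ m)
          ≤⟨ *-monoʳ-≤ (*-nonneg 0≤k (fromℕ-nonneg m)) ratio≤ρ ⟩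
        ρ * (k * fromℕ m)
          ≤⟨ *-monoˡ-≤ 0≤ρ (scaled-mono m≤3q) ⟩
        ρ * (k * fromℕ (3 ℕ.* q))
          ∎)

-- The constant and the removal of the additive term.

theorem2 : ∀ {c ℓ₁ ℓ₂ ℓ₃ o p} (ℝ : RealNumbers c ℓ₁ ℓ₂ ℓ₃) →
    let open RealNumbers ℝ in
    ∃[ κ ] 0# < κ ×
    (∀ (s : ℕ) .{{_ : NonZero s}} → let open OMFLP ℝ s in
    ∀ (A : RandomizedAlgorithm o p) (ratio : ℕ → ℕ → Carrier) →
    CompetitiveOn SinglePoint A (ratio s) →
    ∀ √s → IsSqrt √s (fromℕ s) →
    ∃[ N ] ∀ n → N ℕ.≤ n → κ * √s ≤ ratio s n)
theorem2 ℝ = κ , 0<κ , lowerBound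
  where
  open RealNumbers ℝ hiding (zero)
  open OrderedField ℝ
  open ≤-Reasoning

  κ : Carrier
  -- From `√s ≤ 2 * q` and an optimum of at most `3 * k * q`, the ratio `κ * √s` allows at most
  -- `6 * κ * k * q * q`, which is half of the forced cost.
  κ = 1# / 12

  12κ≈1 : κ * fromℕ 12 ≈ 1#
  12κ≈1 = /-*-cancel 1# 12

  0<κ : 0# < κ
  0<κ = positive-multiple 12 (begin-strict
    0#             <⟨ 0<1 ⟩
    1#             ≈⟨ 12κ≈1 ⟨
    κ * fromℕ 12   ≈⟨ *-comm κ (fromℕ 12) ⟩
    fromℕ 12 * κ   ∎)

  -- The multiplicative term is at most half of the left-hand side. Doubling the inequality and
  -- cancelling one copy leaves `a + a`, whatever `k` is.
  absorb : ∀ {r k a} q → 0# ≤ k → r ≤ fromℕ (2 ℕ.* q) →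
           k * fromℕ (q ℕ.* q) ≤ κ * r * (k * fromℕ (3 ℕ.* q)) + a →
           k * fromℕ (q ℕ.* q) ≤ a + a
  absorb {r} {k} {a} q 0≤k r≤2q lower = +-cancelʳ-≤ kq² (begin
    kq² + kq²                                              ≤⟨ +-mono-≤ kq²≤6κkq²+a kq²≤6κkq²+a ⟩
    (κ * fromℕ 6 * kq² + a) + (κ * fromℕ 6 * kq² + a)      ≈⟨ double κ (fromℕ 6) kq² a ⟩
    (a + a) + κ * (fromℕ 6 + fromℕ 6) * kq²                ≈⟨ +-congˡ (*-congʳ (*-congˡ (fromℕ-+ 6 6))) ⟨
    (a + a) + κ * fromℕ 12 * kq²                           ≈⟨ +-congˡ (*-congʳ 12κ≈1) ⟩
    (a + a) + 1# * kq²                                     ≈⟨ +-congˡ (*-identityˡ kq²) ⟩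
    (a + a) + kq²                                          ∎)
    where
    open SemiringSolver commutativeSemiring

    kq² k3q : Carrier
    kq² = k * fromℕ (q ℕ.* q)
    k3q = k * fromℕ (3 ℕ.* q)

    double : ∀ x y z a → (x * y * z + a) + (x * y * z + a) ≈ (a + a) + x * (y + y) * z
    double = solve 4 (λ x y z a →
      ((x :* y :* z :+ a) :+ (x :* y :* z :+ a)) := ((a :+ a) :+ x :* (y :+ y) :* z)) refl

    regroup : ∀ x u v y z → x * (u * z) * (y * (v * z)) ≈ x * (u * v) * (y * (z * z))
    regroup = solve 5 (λ x u v y z →
      (x :* (u :* z) :* (y :* (v :* z))) := (x :* (u :* v) :* (y :* (z :* z)))) refl

    kq²≤6κkq²+a : kq² ≤ κ * fromℕ 6 * kq² + a
    kq²≤6κkq²+a = begin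
      kq²                                  ≤⟨ lower ⟩
      κ * r * k3q + a
        ≤⟨ +-monoˡ-≤ a (*-monoʳ-≤ (*-nonneg 0≤k (fromℕ-nonneg (3 ℕ.* q))) (*-monoˡ-≤ (<⇒≤ 0<κ) r≤2q)) ⟩
      κ * fromℕ (2 ℕ.* q) * k3q + a
        ≈⟨ +-congʳ (*-cong (*-congˡ (fromℕ-* 2 q)) (*-congˡ (fromℕ-* 3 q))) ⟩
      κ * (fromℕ 2 * fromℕ q) * (k * (fromℕ 3 * fromℕ q)) + a
        ≈⟨ +-congʳ (regroup κ (fromℕ 2) (fromℕ 3) k (fromℕ q)) ⟩
      κ * (fromℕ 2 * fromℕ 3) * (k * (fromℕ q * fromℕ q)) + a
        ≈⟨ +-congʳ (*-cong (*-congˡ (fromℕ-* 2 3)) (*-congˡ (fromℕ-* q q))) ⟨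
      κ * fromℕ 6 * kq² + a                ∎

  lowerBound : ∀ (s : ℕ) .{{_ : NonZero s}} → let open OMFLP ℝ s in
    ∀ (A : RandomizedAlgorithm _ _) (ratio : ℕ → ℕ → Carrier) →
    CompetitiveOn SinglePoint A (ratio s) →
    ∀ √s → IsSqrt √s (fromℕ s) →
    ∃[ N ] ∀ n → N ℕ.≤ n → κ * √s ≤ ratio s n
  lowerBound s A ratio (a , competitive) √s isSqrt with isqrt s
  ... | zero , _ , s<1 = ⊥-elim (ℕ.<⇒≱ s<1 (ℕ.>-nonZero⁻¹ s))
  ... | q@(suc q-1) , q²≤s , s<[1+q]² = q , proof
    where
    √s≤2q : √s ≤ fromℕ (2 ℕ.* q)
    -- Since `q ≥ 1`, `s < (1 + q) * (1 + q) ≤ (2 * q) * (2 * q)`.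
    √s≤2q = sqrt≤ {m = 2 ℕ.* q} isSqrt (ℕ.≤-trans (ℕ.<⇒≤ s<[1+q]²) (ℕ.*-mono-≤ 1+q≤2q 1+q≤2q))
      where
      1+q≤2q : suc q ℕ.≤ 2 ℕ.* q
      1+q≤2q = ℕ.+-mono-≤ {1} (s≤s z≤n) (ℕ.m≤m+n q 0)

    proof : ∀ n → q ℕ.≤ n → κ * √s ≤ ratio s n
    -- The goal is a negation, so `ratio s n < κ * √s` is given and `ρ = κ * √s` works. As `a` does
    -- not depend on the instance, the scale `k = j` can be chosen beyond `a + a`.
    proof n q≤n ratio<κ√s with archimedean (a + a)
    ... | j , a+a<j = <-irrefl refl (begin-strict
      a + a                        <⟨ a+a<j ⟩
      fromℕ j                      ≤⟨ fromℕ-mono-≤ (ℕ.m≤m*n j (q ℕ.* q)) ⟩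
      fromℕ (j ℕ.* (q ℕ.* q))      ≈⟨ fromℕ-* j (q ℕ.* q) ⟩
      fromℕ j * fromℕ (q ℕ.* q)    ≤⟨ absorb q (fromℕ-nonneg j) √s≤2q
        (LowerBound.averageCostBound ℝ s A competitive (fromℕ-nonneg j) q n q²≤s q≤n
          (*-nonneg (<⇒≤ 0<κ) (proj₁ isSqrt)) (<⇒≤ ratio<κ√s)) ⟩
      a + a                        ∎)
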